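{- For any positive odd integer $m$, the diagonal binary $\mathbb Z$-lattice $\ell=\langle 1,m\rangle$ is not recoverable.
   Context: A $\mathbb Z$-lattice is a free $\mathbb Z$-module $L$ of finite rank with a positive definite symmetric bilinear form $B:L\times L\to\mathbb Z$ (integral valued). $\langle a_1,\dots,a_k\rangle$ denotes the $\mathbb Z$-lattice with an orthogonal basis $x_1,\dots,x_k$ satisfying $B(x_i,x_i)=a_i$. A $\mathbb Z$-lattice $\ell$ is represented by $L$ if there is a $\mathbb Z$-linear map $\sigma:\ell\to L$ with $B(\sigma x,\sigma y)=B(x,y)$ for all $x,y\in\ell$. A $\mathbb Z$-lattice $\ell$ is recoverable if there is a finite set $\{\ell_1,\dots,\ell_t\}$ of proper sublattices of $\ell$ such that every $\mathbb Z$-lattice (of any rank) that represents all of $\ell_1,\dots,\ell_t$ also represents $\ell$. -}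

module Defs where

open import Algebra.Module.Bundles using (LeftModule)
open import Algebra.Module.Morphism.Structures using (IsLeftModuleHomomorphism)
import Algebra.Construct.Pointwise as Pointwise
import Algebra.Properties.Monoid.Sum as MonoidSum
import Algebra.Properties.CommutativeMonoid.Sum as CommutativeMonoidSum
import Algebra.Properties.Semiring.Sum as SemiringSum
open import Data.Bool.Base using (if_then_else_)
open import Data.Empty using (⊥-elim)
open import Data.Fin.Base using (Fin; zero; suc)
open import Data.Fin.Properties using () renaming (_≟_ to _≟ᶠ_)
open import Data.Integer.Base hiding (suc)
open import Data.Integer.Properties
open import Data.List.Base using (List)
open import Data.List.Relation.Unary.All using (All)
open import Data.Nat.Base using (ℕ; zero; suc; z≤n)
open import Data.Product.Base using (∃; _×_; _,_; proj₁; proj₂)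
open import Data.Sum.Base using ([_,_])
open import Data.Vec.Functional using (Vector; []; _∷_; tail)
open import Function.Base using (_∘_)
open import Level using (0ℓ)
open import Relation.Binary.PropositionalEquality hiding ([_])
open import Relation.Nullary using (¬_; does; yes; no)
open import Relation.Unary using (Pred; _∈_)

ℤ-Module : Set₁
ℤ-Module = LeftModule +-*-ring 0ℓ 0ℓ

module _ (M : ℤ-Module) where
  open LeftModule M

  linearCombination : ∀ {n} → Vector ℤ n → Vector Carrierᴹ n → Carrierᴹ
  linearCombination c v = sum (λ i → c i *ₗ v i)
    where open MonoidSum +ᴹ-monoid using (sum)

  LinearlyIndependent : ∀ {n} → Vector Carrierᴹ n → Set
  LinearlyIndependent v = ∀ c → linearCombination c v ≈ᴹ 0ᴹ → ∀ i → c i ≡ 0ℤ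

record ℤ-Lattice : Set₁ where
  field
    ℤ-module : ℤ-Module

  open LeftModule ℤ-module public
    using (Carrierᴹ; _≈ᴹ_; _+ᴹ_; _*ₗ_; 0ᴹ; -ᴹ_; rawLeftModule)

  field
    rank          : ℕ
    basis         : Vector Carrierᴹ rank
    basis-spans   : ∀ x → ∃ λ c → x ≈ᴹ linearCombination ℤ-module c basis
    basis-indep   : LinearlyIndependent ℤ-module basis

    -- Linearity in the second argument follows from B-sym.
    B             : Carrierᴹ → Carrierᴹ → ℤ
    B-cong        : ∀ {x x′ y y′} → x ≈ᴹ x′ → y ≈ᴹ y′ → B x y ≡ B x′ y′
    B-sym         : ∀ x y → B x y ≡ B y x
    B-+           : ∀ x y z → B (x +ᴹ y) z ≡ B x z + B y z
    B-*           : ∀ c x z → B (c *ₗ x) z ≡ c * B x z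
    B-positive    : ∀ x → ¬ (x ≈ᴹ 0ᴹ) → 0ℤ < B x x

_Represents_ : ℤ-Lattice → ℤ-Lattice → Set
L Represents ℓ = ∃ λ (σ : ℓ.Carrierᴹ → L.Carrierᴹ) →
    IsLeftModuleHomomorphism ℓ.rawLeftModule L.rawLeftModule σ
  × (∀ x y → L.B (σ x) (σ y) ≡ ℓ.B x y)
  where
  module ℓ = ℤ-Lattice ℓ
  module L = ℤ-Lattice L

-- A submodule, given as a subset, that is itself free of finite rank. Over ℤ
-- every submodule of a lattice has a basis classically; constructively the
-- basis has to be part of the data.
record Sublattice (L : ℤ-Lattice) : Set₁ where
  open ℤ-Lattice L using (ℤ-module; Carrierᴹ; _≈ᴹ_; _+ᴹ_; _*ₗ_; 0ᴹ; -ᴹ_)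
  field
    subset       : Pred Carrierᴹ 0ℓ
    resp-≈       : ∀ {x y} → x ≈ᴹ y → x ∈ subset → y ∈ subset
    0-closed     : 0ᴹ ∈ subset
    +-closed     : ∀ {x y} → x ∈ subset → y ∈ subset → (x +ᴹ y) ∈ subset
    neg-closed   : ∀ {x} → x ∈ subset → (-ᴹ x) ∈ subset
    *ₗ-closed    : ∀ c {x} → x ∈ subset → (c *ₗ x) ∈ subset

    rank         : ℕ
    basis        : Vector Carrierᴹ rank
    basis-∈      : ∀ i → basis i ∈ subset
    basis-spans  : ∀ x → x ∈ subset → ∃ λ c → x ≈ᴹ linearCombination ℤ-module c basis
    basis-indep  : LinearlyIndependent ℤ-module basis

Proper : ∀ {L} → Sublattice L → Set
Proper K = ¬ (∀ x → x ∈ Sublattice.subset K)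

-- The sublattice as a lattice in its own right, with the restricted form.
module _ {L : ℤ-Lattice} (K : Sublattice L) where
  private
    module M = LeftModule (ℤ-Lattice.ℤ-module L)
    module L = ℤ-Lattice L
    module K = Sublattice K

  subModule : ℤ-Module
  subModule = record
    { Carrierᴹ     = ∃ K.subset
    ; _≈ᴹ_         = λ x y → proj₁ x M.≈ᴹ proj₁ y
    ; _+ᴹ_         = λ (x , p) (y , q) → x M.+ᴹ y , K.+-closed p q
    ; _*ₗ_         = λ c (x , p) → c M.*ₗ x , K.*ₗ-closed c p
    ; 0ᴹ           = M.0ᴹ , K.0-closed
    ; -ᴹ_          = λ (x , p) → M.-ᴹ x , K.neg-closed p
    ; isLeftModule = record
      { isLeftSemimodule = record
        { +ᴹ-isCommutativeMonoid = record
          { isMonoid = record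
            { isSemigroup = record
              { isMagma = record
                { isEquivalence = record
                  { refl = M.≈ᴹ-refl ; sym = M.≈ᴹ-sym ; trans = M.≈ᴹ-trans }
                ; ∙-cong = M.+ᴹ-cong
                }
              ; assoc = λ x y z → M.+ᴹ-assoc (proj₁ x) (proj₁ y) (proj₁ z)
              }
            ; identity = M.+ᴹ-identityˡ ∘ proj₁ , M.+ᴹ-identityʳ ∘ proj₁
            }
          ; comm = λ x y → M.+ᴹ-comm (proj₁ x) (proj₁ y)
          }
        ; isPreleftSemimodule = record
          { *ₗ-cong      = M.*ₗ-cong
          ; *ₗ-zeroˡ     = M.*ₗ-zeroˡ ∘ proj₁
          ; *ₗ-distribʳ  = λ x c d → M.*ₗ-distribʳ (proj₁ x) c d
          ; *ₗ-identityˡ = M.*ₗ-identityˡ ∘ proj₁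
          ; *ₗ-assoc     = λ c d x → M.*ₗ-assoc c d (proj₁ x)
          ; *ₗ-zeroʳ     = M.*ₗ-zeroʳ
          ; *ₗ-distribˡ  = λ c x y → M.*ₗ-distribˡ c (proj₁ x) (proj₁ y)
          }
        }
      ; -ᴹ‿cong    = M.-ᴹ‿cong
      ; -ᴹ‿inverse = M.-ᴹ‿inverseˡ ∘ proj₁ , M.-ᴹ‿inverseʳ ∘ proj₁
      }
    }

  private
    combo-proj₁ : ∀ {n} c (v : Vector (∃ K.subset) n) →
      proj₁ (linearCombination subModule c v)
        ≡ linearCombination L.ℤ-module c (proj₁ ∘ v)
    combo-proj₁ {zero}  c v = refl
    combo-proj₁ {suc n} c v =
      cong ((c zero M.*ₗ proj₁ (v zero)) M.+ᴹ_) (combo-proj₁ (tail c) (tail v))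

    subBasis : Vector (∃ K.subset) K.rank
    subBasis i = K.basis i , K.basis-∈ i

  asLattice : ℤ-Lattice
  asLattice = record
    { ℤ-module    = subModule
    ; rank        = K.rank
    ; basis       = subBasis
    ; basis-spans = λ (x , p) → let (c , eq) = K.basis-spans x p in
        c , subst (x M.≈ᴹ_) (sym (combo-proj₁ c subBasis)) eq
    ; basis-indep = λ c eq →
        K.basis-indep c (subst (M._≈ᴹ M.0ᴹ) (combo-proj₁ c subBasis) eq)
    ; B           = λ x y → L.B (proj₁ x) (proj₁ y)
    ; B-cong      = L.B-cong
    ; B-sym       = λ x y → L.B-sym (proj₁ x) (proj₁ y)
    ; B-+         = λ x y z → L.B-+ (proj₁ x) (proj₁ y) (proj₁ z)
    ; B-*         = λ c x z → L.B-* c (proj₁ x) (proj₁ z)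
    ; B-positive  = λ x → L.B-positive (proj₁ x)
    }

Recoverable : ℤ-Lattice → Set₁
Recoverable ℓ = ∃ λ (Ks : List (Sublattice ℓ)) →
    All Proper Ks
  × (∀ (L : ℤ-Lattice) → All (λ K → L Represents asLattice K) Ks → L Represents ℓ)

ℤ^_ : ℕ → ℤ-Module
ℤ^ k = record
  { Carrierᴹ     = Vector ℤ k
  ; _*ₗ_         = λ c x i → c * x i
  ; isLeftModule = record
    { isLeftSemimodule = record
      { +ᴹ-isCommutativeMonoid = AbelianGroup.isCommutativeMonoid
      ; isPreleftSemimodule = record
        { *ₗ-cong      = λ c≡d x≗y i → cong₂ _*_ c≡d (x≗y i)
        ; *ₗ-zeroˡ     = λ x i → *-zeroˡ (x i)
        ; *ₗ-distribʳ  = λ x c d i → *-distribʳ-+ (x i) c d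
        ; *ₗ-identityˡ = λ x i → *-identityˡ (x i)
        ; *ₗ-assoc     = λ c d x i → *-assoc c d (x i)
        ; *ₗ-zeroʳ     = λ c i → *-zeroʳ c
        ; *ₗ-distribˡ  = λ c x y i → *-distribˡ-+ c (x i) (y i)
        }
      }
    ; -ᴹ‿cong    = AbelianGroup.⁻¹-cong
    ; -ᴹ‿inverse = AbelianGroup.inverse
    }
  }
  where
  import Algebra.Bundles as Bundles
  module AbelianGroup =
    Bundles.AbelianGroup (Pointwise.abelianGroup (Fin k) +-0-abelianGroup)

standardBasis : ∀ {k} → Vector (Vector ℤ k) k
standardBasis i j = if does (i ≟ᶠ j) then 1ℤ else 0ℤ

module Σℤ = MonoidSum +-0-monoid

diagonalForm : ∀ {k} → Vector ℤ k → Vector ℤ k → Vector ℤ k → ℤ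
diagonalForm a x y = Σℤ.sum (λ i → a i * (x i * y i))

combo-at : ∀ {k n} c (v : Vector (Vector ℤ k) n) j →
  linearCombination (ℤ^ k) c v j ≡ Σℤ.sum (λ i → c i * v i j)
combo-at {n = zero}  c v j = refl
combo-at {n = suc n} c v j =
  cong (λ t → c zero * v zero j + t) (combo-at (tail c) (tail v) j)

sum-δ : ∀ {k} (c : Vector ℤ k) j → Σℤ.sum (λ i → c i * standardBasis i j) ≡ c j
sum-δ {suc k} c zero = trans
  (cong₂ _+_ (*-identityʳ (c zero))
    (trans (Σℤ.sum-cong-≗ (λ i → *-zeroʳ (c (suc i)))) (Σℤ.sum-replicate-zero k)))
  (+-identityʳ (c zero))
sum-δ {suc k} c (suc j) = trans
  (cong₂ _+_ (*-zeroʳ (c zero)) (sum-δ (tail c) j))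
  (+-identityˡ (c (suc j)))

combo-standard : ∀ {k} (c : Vector ℤ k) j →
  linearCombination (ℤ^ k) c standardBasis j ≡ c j
combo-standard c j = trans (combo-at c standardBasis j) (sum-δ c j)

square-nonNeg : ∀ i → 0ℤ ≤ i * i
square-nonNeg (+ n)    = subst (0ℤ ≤_) (pos-* n n) (+≤+ z≤n)
square-nonNeg -[1+ n ] = +≤+ z≤n

square-pos : ∀ i → ¬ (i ≡ 0ℤ) → 0ℤ < i * i
square-pos i i≢0 = ≤∧≢⇒< (square-nonNeg i)
  λ eq → [ i≢0 , i≢0 ] (i*j≡0⇒i≡0∨j≡0 i (sym eq))

*-pos-nonNeg : ∀ {a b} → 0ℤ < a → 0ℤ ≤ b → 0ℤ ≤ a * b
*-pos-nonNeg {a} {b} 0<a 0≤b =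
  subst (_≤ a * b) (*-zeroʳ a)
    (*-monoˡ-≤-nonNeg a {{nonNegative (<⇒≤ 0<a)}} 0≤b)

*-pos-pos : ∀ {a b} → 0ℤ < a → 0ℤ < b → 0ℤ < a * b
*-pos-pos {a} {b} 0<a 0<b =
  subst (_< a * b) (*-zeroʳ a) (*-monoˡ-<-pos a {{positive 0<a}} 0<b)

diagonalForm-nonNeg : ∀ {k} (a x : Vector ℤ k) → (∀ i → 0ℤ < a i) →
  0ℤ ≤ diagonalForm a x x
diagonalForm-nonNeg {zero}  a x pos = ≤-refl
diagonalForm-nonNeg {suc k} a x pos = +-mono-≤
  (*-pos-nonNeg (pos zero) (square-nonNeg (x zero)))
  (diagonalForm-nonNeg (tail a) (tail x) (pos ∘ suc))

diagonalForm-pos : ∀ {k} (a x : Vector ℤ k) → (∀ i → 0ℤ < a i) →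
  ¬ (∀ i → x i ≡ 0ℤ) → 0ℤ < diagonalForm a x x
diagonalForm-pos {zero}  a x pos x≢0 = ⊥-elim (x≢0 λ ())
diagonalForm-pos {suc k} a x pos x≢0 with x zero ≟ 0ℤ
... | yes x₀≡0 = +-mono-≤-<
  (*-pos-nonNeg (pos zero) (square-nonNeg (x zero)))
  (diagonalForm-pos (tail a) (tail x) (pos ∘ suc)
    λ t≡0 → x≢0 λ { zero → x₀≡0 ; (suc i) → t≡0 i })
... | no x₀≢0 = +-mono-<-≤
  (*-pos-pos (pos zero) (square-pos (x zero) x₀≢0))
  (diagonalForm-nonNeg (tail a) (tail x) (pos ∘ suc))

diagonalLattice : ∀ {k} (a : Vector ℤ k) → (∀ i → 0ℤ < a i) → ℤ-Lattice
diagonalLattice {k} a pos = record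
  { ℤ-module    = ℤ^ k
  ; rank        = k
  ; basis       = standardBasis
  ; basis-spans = λ x → x , λ j → sym (combo-standard x j)
  ; basis-indep = λ c eq i → trans (sym (combo-standard c i)) (eq i)
  ; B           = diagonalForm a
  ; B-cong      = λ x≗x′ y≗y′ →
      Σℤ.sum-cong-≗ (λ i → cong (a i *_) (cong₂ _*_ (x≗x′ i) (y≗y′ i)))
  ; B-sym       = λ x y → Σℤ.sum-cong-≗ (λ i → cong (a i *_) (*-comm (x i) (y i)))
  ; B-+         = λ x y z → trans
      (Σℤ.sum-cong-≗ (λ i → trans
        (cong (a i *_) (*-distribʳ-+ (z i) (x i) (y i)))
        (*-distribˡ-+ (a i) (x i * z i) (y i * z i))))
      (∑-distrib-+ (λ i → a i * (x i * z i)) (λ i → a i * (y i * z i)))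
  ; B-*         = λ c x z → trans
      (Σℤ.sum-cong-≗ (λ i → trans
        (cong (a i *_) (*-assoc c (x i) (z i)))
        (trans (sym (*-assoc (a i) c (x i * z i)))
          (trans (cong (_* (x i * z i)) (*-comm (a i) c))
            (*-assoc c (a i) (x i * z i))))))
      (sym (*-distribˡ-sum c (λ i → a i * (x i * z i))))
  ; B-positive  = λ x → diagonalForm-pos a x pos
  }
  where
  open CommutativeMonoidSum +-0-commutativeMonoid using (∑-distrib-+)
  open SemiringSum +-*-semiring using (*-distribˡ-sum)

⟨_,_⟩ : (a b : ℤ) .{{_ : Positive a}} .{{_ : Positive b}} → ℤ-Lattice
⟨ a , b ⟩ = diagonalLattice (a ∷ b ∷ [])
  λ { zero → positive⁻¹ a ; (suc zero) → positive⁻¹ b }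

{-# OPTIONS --safe #-}
module Submission where

-- Given proper sublattices K of ⟨1, m⟩, we build L = ⟨1⟩ ⊥ q₁ ⊥ … ⊥ qₜ with one
-- binary form per sublattice, such that every norm ≤ m of each qᵢ is even. Then
-- the vectors of norm 1 in L are the two generators ± e of ⟨1⟩, and no vector
-- orthogonal to e has the odd norm m, so L does not represent ⟨1, m⟩.
--
-- Writing (x, y) for the coordinates, K is contained in {n ∣ y} or in
-- {n ∣ x − b y} for some n ≥ 2. In the first case (x; y / n) maps K into
-- ⟨1⟩ ⊥ ⟨m n²⟩, and m n² > m. In the second case there is in general a linear
-- functional α on K with α(v) ≡ B(v, v) modulo 2 and B(v, v) − α(v)² positive
-- definite; that difference is the even form q. If n is even we may take n = 2
-- and b ∈ {0, 1}, and then α = y or α = 0. If n is odd we take b odd with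
-- |b| ≤ n and α = (x − b y) / n, the determinant of the remainder being
-- (n² − 1) m − b². For m = 1 the remainder can degenerate when n ∣ x, but then x
-- and y may be interchanged, which reduces to the first case.

open import Defs
open import Algebra.Module.Bundles using (LeftModule)
open import Algebra.Module.Morphism.Structures using (IsLeftModuleHomomorphism)
open import Data.Fin.Base using (zero; suc)
open import Data.Integer.Base hiding (suc)
open import Data.Integer.Divisibility using (_∣_)
open import Data.Integer.Divisibility.Signed
  using (divides; quotient; ∣ᵤ⇒∣; ∣⇒∣ᵤ; ∣-trans; ∣m∣∣m; 0∣⇒≡0; ∣m∣n⇒∣m+n; ∣n⇒∣m*n)
  renaming (_∣_ to _∣ˢ_)
open import Data.Integer.DivMod using (_%ℕ_; _/ℕ_; n%ℕd<d; a≡a%ℕn+[a/ℕn]*n)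
open import Data.Integer.Properties
open import Algebra.Properties.CommutativeSemigroup +-commutativeSemigroup
  using () renaming (interchange to +-interchange)
open import Data.Integer.Tactic.RingSolver using (solve-∀)
open import Data.List.Base using (List)
open import Data.List.Relation.Unary.All as All using (All)
open import Data.Nat.Base as ℕ using (ℕ; zero; suc; z≤n; s≤s)
import Data.Nat.Divisibility as ℕᵈ
open import Data.Nat.GCD using (GCD; module Bézout)
import Data.Nat.Properties as ℕₚ
open import Data.Product.Base using (∃; ∃₂; _×_; _,_; proj₂)
open import Data.Sum.Base using (_⊎_; inj₁; inj₂; [_,_]; [_,_]′)
open import Data.Vec.Functional using (Vector; []; _∷_; head; tail)
open import Function.Base using (_∘_; id)
open import Relation.Binary.PropositionalEquality hiding ([_])
open import Relation.Nullary using (¬_; yes; no; contradiction)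

-- Integer arithmetic: Bézout, parity, sums of nonnegative terms

i+j≡k⇒i≡k-j : ∀ i j {k} → i + j ≡ k → i ≡ k - j
i+j≡k⇒i≡k-j i j eq = trans (cancel i j) (cong (_- j) eq)
  where
  cancel : ∀ i j → i ≡ i + j - j
  cancel = solve-∀

-- The sign is a factor, so that it can be absorbed into a Bézout coefficient or into the argument
-- of a linear functional.
+∣i∣≡ε*i : ∀ i → ∃ λ ε → + ∣ i ∣ ≡ ε * i
+∣i∣≡ε*i (+ n)    = 1ℤ , sym (*-identityˡ (+ n))
+∣i∣≡ε*i -[1+ n ] = -1ℤ , sym (-1*i≡-i -[1+ n ])

-- Bézout for the absolute values, with the signs moved into the coefficients. The combination
-- itself serves as the gcd, so a linear functional attains it at the same combination of vectors.
bézout : ∀ i j → ∃₂ λ s t → ((s * i + t * j) ∣ˢ i) × ((s * i + t * j) ∣ˢ j)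
bézout i j with +∣i∣≡ε*i i | +∣i∣≡ε*i j | Bézout.lemma ∣ i ∣ ∣ j ∣
... | ε , εi | δ , δj | Bézout.result d g identity = combine identity
  where
  Combination : Set
  Combination = ∃₂ λ s t → ((s * i + t * j) ∣ˢ i) × ((s * i + t * j) ∣ˢ j)

  divisors : ∀ s t → + d ≡ s * i + t * j → Combination
  divisors s t eq = s , t , subst (λ e → (e ∣ˢ i) × (e ∣ˢ j)) eq
    (∣ᵤ⇒∣ (GCD.gcd∣m g) , ∣ᵤ⇒∣ (GCD.gcd∣n g))

  lift : ∀ x y a b → d ℕ.+ y ℕ.* b ≡ x ℕ.* a → + d ≡ + x * + a - + y * + b
  lift x y a b eq = i+j≡k⇒i≡k-j (+ d) (+ y * + b)
    (trans (cong (λ t → + d + t) (sym (pos-* y b))) (trans (cong +_ eq) (pos-* x a)))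

  combine : Bézout.Identity d ∣ i ∣ ∣ j ∣ → Combination
  combine (Bézout.+- x y eq) = divisors (+ x * ε) (- (+ y * δ))
    (trans (lift x y _ _ eq)
      (trans (cong₂ (λ a b → + x * a - + y * b) εi δj) (rearrange (+ x) (+ y) ε δ i j)))
    where
    rearrange : ∀ x y ε δ i j →
      x * (ε * i) - y * (δ * j) ≡ x * ε * i + - (y * δ) * j
    rearrange = solve-∀
  combine (Bézout.-+ x y eq) = divisors (- (+ x * ε)) (+ y * δ)
    (trans (lift y x _ _ eq)
      (trans (cong₂ (λ a b → + y * b - + x * a) εi δj) (rearrange (+ x) (+ y) ε δ i j)))
    where
    rearrange : ∀ x y ε δ i j →
      y * (δ * j) - x * (ε * i) ≡ - (x * ε) * i + y * δ * j
    rearrange = solve-∀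

even⊎odd : ∀ i → ∃ λ h → i ≡ h * + 2 ⊎ i ≡ 1ℤ + h * + 2
even⊎odd i with i %ℕ 2 | n%ℕd<d i 2 | a≡a%ℕn+[a/ℕn]*n i 2
... | 0           | _ | eq = i /ℕ 2 , inj₁ (trans eq (+-identityˡ _))
... | 1           | _ | eq = i /ℕ 2 , inj₂ eq
... | suc (suc _) | s≤s (s≤s ()) | _

i*i≡+∣i∣*∣i∣ : ∀ i → i * i ≡ + (∣ i ∣ ℕ.* ∣ i ∣)
i*i≡+∣i∣*∣i∣ i = trans (sym (0≤i⇒+∣i∣≡i (square-nonNeg i))) (cong +_ (abs-* i i))

square≡0 : ∀ i → i * i ≡ 0ℤ → i ≡ 0ℤ
square≡0 i eq = [ id , id ] (i*j≡0⇒i≡0∨j≡0 i eq)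

nonNeg-sum≡0 : ∀ {i j} → 0ℤ ≤ i → 0ℤ ≤ j → i + j ≡ 0ℤ → i ≡ 0ℤ × j ≡ 0ℤ
nonNeg-sum≡0 {+ i} {+ j} _ _ eq =
  cong +_ (ℕₚ.m+n≡0⇒m≡0 i (+-injective eq)) ,
  cong +_ (ℕₚ.m+n≡0⇒n≡0 i (+-injective eq))

≤-summandˡ : ∀ {i j k} → 0ℤ ≤ j → i + j ≤ k → i ≤ k
≤-summandˡ {i} {j} 0≤j = ≤-trans (i≤i+j i j {{nonNegative 0≤j}})

≤-summandʳ : ∀ {i j k} → 0ℤ ≤ i → i + j ≤ k → j ≤ k
≤-summandʳ {i} {j} 0≤i = ≤-trans (i≤j+i j i {{nonNegative 0≤i}})

-- Linear functionals

module _ (N : ℤ-Module) where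
  open LeftModule N

  record IsLinear (f : Carrierᴹ → ℤ) : Set where
    field
      ⟦⟧-cong : ∀ {x y} → x ≈ᴹ y → f x ≡ f y
      +-homo  : ∀ x y → f (x +ᴹ y) ≡ f x + f y
      *-homo  : ∀ c x → f (c *ₗ x) ≡ c * f x

    0-homo : f 0ᴹ ≡ 0ℤ
    0-homo = trans (⟦⟧-cong (≈ᴹ-sym (*ₗ-zeroˡ 0ᴹ))) (*-homo 0ℤ 0ᴹ)

    neg-homo : ∀ x → f (-ᴹ x) ≡ - f x
    neg-homo x = trans
      (i+j≡k⇒i≡k-j (f (-ᴹ x)) (f x)
        (trans (sym (+-homo (-ᴹ x) x)) (trans (⟦⟧-cong (-ᴹ‿inverseˡ x)) 0-homo)))
      (+-identityˡ (- f x))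

module _ {N : ℤ-Module} where
  open LeftModule N
  open IsLinear

  zero-linear : IsLinear N (λ _ → 0ℤ)
  zero-linear = record
    { ⟦⟧-cong = λ _ → refl ; +-homo = λ _ _ → refl ; *-homo = λ c _ → sym (*-zeroʳ c) }

  +-linear : ∀ {f g} → IsLinear N f → IsLinear N g → IsLinear N (λ x → f x + g x)
  +-linear {f} {g} F G = record
    { ⟦⟧-cong = λ eq → cong₂ _+_ (⟦⟧-cong F eq) (⟦⟧-cong G eq)
    ; +-homo  = λ x y → trans (cong₂ _+_ (+-homo F x y) (+-homo G x y))
                              (+-interchange (f x) (f y) (g x) (g y))
    ; *-homo  = λ c x → trans (cong₂ _+_ (*-homo F c x) (*-homo G c x))
                              (sym (*-distribˡ-+ c (f x) (g x)))
    }

  *-linear : ∀ {f} → IsLinear N f → ∀ k → IsLinear N (λ x → f x * k)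
  *-linear {f} F k = record
    { ⟦⟧-cong = λ eq → cong (_* k) (⟦⟧-cong F eq)
    ; +-homo  = λ x y → trans (cong (_* k) (+-homo F x y)) (*-distribʳ-+ k (f x) (f y))
    ; *-homo  = λ c x → trans (cong (_* k) (*-homo F c x)) (*-assoc c (f x) k)
    }

  quotient-linear : ∀ {f u} n .{{_ : NonZero n}} → IsLinear N f →
    (∀ x → f x ≡ u x * n) → IsLinear N u
  quotient-linear {f} {u} n F eq = record
    { ⟦⟧-cong = λ x≈y → *-cancelʳ-≡ _ _ n
        (trans (sym (eq _)) (trans (⟦⟧-cong F x≈y) (eq _)))
    ; +-homo  = λ x y → *-cancelʳ-≡ _ _ n
        (trans (sym (eq _)) (trans (+-homo F x y)
          (trans (cong₂ _+_ (eq x) (eq y)) (sym (*-distribʳ-+ n (u x) (u y))))))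
    ; *-homo  = λ c x → *-cancelʳ-≡ _ _ n
        (trans (sym (eq _)) (trans (*-homo F c x)
          (trans (cong (c *_) (eq x)) (sym (*-assoc c (u x) n)))))
    }

-- The image of a linear functional

module _ (N : ℤ-Lattice) where
  open ℤ-Lattice N

  -- Folding `bézout` over the basis produces one vector whose value divides the values at all basis
  -- vectors, hence every value.
  image-principal : ∀ {f} → IsLinear ℤ-module f → ∃ λ k → ∀ x → f k ∣ˢ f x
  image-principal {f} F =
    let k , k∣basis = common basis in
    k , λ x → let c , eq = basis-spans x in
      subst (f k ∣ˢ_) (sym (⟦⟧-cong eq)) (∣-combination (f k) c basis k∣basis)
    where
    open IsLinear F

    ∣-combination : ∀ d {n} c (v : Vector Carrierᴹ n) → (∀ i → d ∣ˢ f (v i)) →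
      d ∣ˢ f (linearCombination ℤ-module c v)
    ∣-combination d {zero}  c v d∣v = divides 0ℤ 0-homo
    ∣-combination d {suc n} c v d∣v = subst (d ∣ˢ_)
      (sym (trans (+-homo _ _) (cong₂ _+_ (*-homo (c zero) (v zero)) refl)))
      (∣m∣n⇒∣m+n (∣n⇒∣m*n (c zero) (d∣v zero))
                 (∣-combination d (tail c) (tail v) (d∣v ∘ suc)))

    common : ∀ {n} (v : Vector Carrierᴹ n) → ∃ λ k → ∀ i → f k ∣ˢ f (v i)
    common {zero}  v = 0ᴹ , λ ()
    common {suc n} v with common (tail v)
    ... | k , k∣tail with bézout (f (v zero)) (f k)
    ... | s , t , ∣v₀ , ∣k =
      (s *ₗ v zero) +ᴹ (t *ₗ k) ,
      λ { zero    → subst (_∣ˢ _) (sym value) ∣v₀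
        ; (suc i) → ∣-trans (subst (_∣ˢ _) (sym value) ∣k) (k∣tail i) }
      where
      value : f ((s *ₗ v zero) +ᴹ (t *ₗ k)) ≡ s * f (v zero) + t * f k
      value = trans (+-homo _ _) (cong₂ _+_ (*-homo s (v zero)) (*-homo t k))

  onto⊎divisible : ∀ {f} → IsLinear ℤ-module f →
      (∃ λ e → f e ≡ 1ℤ)
    ⊎ (∃₂ λ n u → 2 ℕ.≤ n × IsLinear ℤ-module u × (∀ x → f x ≡ u x * + n))
  onto⊎divisible {f} F with image-principal F
  ... | k , k∣f with +∣i∣≡ε*i (f k)
  ... | ε , ∣fk∣≡ε*fk = split ∣ f k ∣
    (trans (IsLinear.*-homo F ε k) (sym ∣fk∣≡ε*fk)) λ x → ∣-trans ∣m∣∣m (k∣f x)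
    where
    split : ∀ g → f (ε *ₗ k) ≡ + g → (∀ x → + g ∣ˢ f x) → _
    -- Here `f` vanishes identically and every modulus divides it; 2 is the least one allowed.
    split 0               _    0∣f = inj₂
      (2 , (λ _ → 0ℤ) , s≤s (s≤s z≤n) , zero-linear , λ x → 0∣⇒≡0 (0∣f x))
    split 1               fe≡1 _   = inj₁ (ε *ₗ k , fe≡1)
    split n@(suc (suc _)) _    n∣f = inj₂
      (n , (λ x → quotient (n∣f x)) , s≤s (s≤s z≤n) ,
        quotient-linear (+ n) F f≡u*n , f≡u*n)
      where
      f≡u*n : ∀ x → f x ≡ quotient (n∣f x) * + n
      f≡u*n x with divides _ eq ← n∣f x = eq

-- Positive definite forms and their orthogonal sums

-- Positivity is split into two fields because a sum of nonnegative terms vanishes only if each term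
-- does, which makes both fields pass to orthogonal sums.
record PositiveForm (k : ℕ) : Set where
  field
    B          : Vector ℤ k → Vector ℤ k → ℤ
    B-cong     : ∀ {x x′ y y′} → x ≗ x′ → y ≗ y′ → B x y ≡ B x′ y′
    B-sym      : ∀ x y → B x y ≡ B y x
    B-+        : ∀ x y z → B (λ i → x i + y i) z ≡ B x z + B y z
    B-*        : ∀ c x z → B (λ i → c * x i) z ≡ c * B x z
    B-nonNeg   : ∀ x → 0ℤ ≤ B x x
    B-definite : ∀ x → B x x ≡ 0ℤ → ∀ i → x i ≡ 0ℤ

  B-zeroˡ : ∀ {x} y → (∀ i → x i ≡ 0ℤ) → B x y ≡ 0ℤ
  B-zeroˡ y x≡0 = trans (B-cong x≡0 (λ _ → refl)) (B-* 0ℤ (λ _ → 0ℤ) y)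

lattice : ∀ {k} → PositiveForm k → ℤ-Lattice
lattice {k} F = record
  { ℤ-module    = ℤ^ k
  ; rank        = k
  ; basis       = standardBasis
  ; basis-spans = λ x → x , λ j → sym (combo-standard x j)
  ; basis-indep = λ c eq i → trans (sym (combo-standard c i)) (eq i)
  ; B           = B
  ; B-cong      = B-cong
  ; B-sym       = B-sym
  ; B-+         = B-+
  ; B-*         = B-*
  ; B-positive  = λ x x≢0 → ≤∧≢⇒< (B-nonNeg x) (λ eq → x≢0 (B-definite x (sym eq)))
  }
  where open PositiveForm F

trivial : PositiveForm 0
trivial = record
  { B          = λ _ _ → 0ℤ
  ; B-cong     = λ _ _ → refl
  ; B-sym      = λ _ _ → refl
  ; B-+        = λ _ _ _ → refl
  ; B-*        = λ c _ _ → sym (*-zeroʳ c)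
  ; B-nonNeg   = λ _ → ≤-refl
  ; B-definite = λ _ _ ()
  }

⟨1⟩⊥_ : ∀ {k} → PositiveForm k → PositiveForm (suc k)
⟨1⟩⊥_ F = record
  { B          = λ x y → head x * head y + B (tail x) (tail y)
  ; B-cong     = λ x≗x′ y≗y′ → cong₂ _+_ (cong₂ _*_ (x≗x′ zero) (y≗y′ zero))
                                         (B-cong (x≗x′ ∘ suc) (y≗y′ ∘ suc))
  ; B-sym      = λ x y → cong₂ _+_ (*-comm (head x) (head y)) (B-sym (tail x) (tail y))
  ; B-+        = λ x y z → trans
      (cong₂ _+_ (*-distribʳ-+ (head z) (head x) (head y)) (B-+ (tail x) (tail y) (tail z)))
      (+-interchange (head x * head z) (head y * head z) _ _)
  ; B-*        = λ c x z → trans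
      (cong₂ _+_ (*-assoc c (head x) (head z)) (B-* c (tail x) (tail z)))
      (sym (*-distribˡ-+ c (head x * head z) _))
  ; B-nonNeg   = λ x → +-mono-≤ (square-nonNeg (head x)) (B-nonNeg (tail x))
  ; B-definite = λ x eq →
      let x₀²≡0 , rest≡0 = nonNeg-sum≡0 (square-nonNeg (head x)) (B-nonNeg (tail x)) eq
      in λ { zero    → square≡0 (head x) x₀²≡0
           ; (suc i) → B-definite (tail x) rest≡0 i }
  }
  where open PositiveForm F

-- The Gram matrix has rows (a, b) and (b, c); the two inequalities are Sylvester's criterion.
record BinaryForm : Set where
  field
    a b c : ℤ
    a>0   : 0ℤ < a
    det>0 : 0ℤ < a * c - b * b

  gram : (x₀ x₁ y₀ y₁ : ℤ) → ℤ
  gram x₀ x₁ y₀ y₁ = a * (x₀ * y₀) + (b * (x₀ * y₁ + x₁ * y₀) + c * (x₁ * y₁))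

  private
    -- After multiplication by `a` the norm is a square plus `det` times a square, which yields both
    -- nonnegativity and definiteness.
    complete-square : ∀ a b c x₀ x₁ →
      a * (a * (x₀ * x₀) + (b * (x₀ * x₁ + x₁ * x₀) + c * (x₁ * x₁)))
        ≡ (a * x₀ + b * x₁) * (a * x₀ + b * x₁) + (a * c - b * b) * (x₁ * x₁)
    complete-square = solve-∀

    instance
      a-positive : Positive a
      a-positive = positive a>0

    square-term : ∀ x₁ → 0ℤ ≤ (a * c - b * b) * (x₁ * x₁)
    square-term x₁ = *-pos-nonNeg det>0 (square-nonNeg x₁)

  gram-cong : ∀ {x₀ x₀′ x₁ x₁′ y₀ y₀′ y₁ y₁′} →
    x₀ ≡ x₀′ → x₁ ≡ x₁′ → y₀ ≡ y₀′ → y₁ ≡ y₁′ →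
    gram x₀ x₁ y₀ y₁ ≡ gram x₀′ x₁′ y₀′ y₁′
  gram-cong refl refl refl refl = refl

  gram-sym : ∀ x₀ x₁ y₀ y₁ → gram x₀ x₁ y₀ y₁ ≡ gram y₀ y₁ x₀ x₁
  gram-sym = identity a b c
    where
    identity : ∀ a b c x₀ x₁ y₀ y₁ →
      a * (x₀ * y₀) + (b * (x₀ * y₁ + x₁ * y₀) + c * (x₁ * y₁))
        ≡ a * (y₀ * x₀) + (b * (y₀ * x₁ + y₁ * x₀) + c * (y₁ * x₁))
    identity = solve-∀

  gram-+ : ∀ x₀ x₁ y₀ y₁ z₀ z₁ →
    gram (x₀ + y₀) (x₁ + y₁) z₀ z₁ ≡ gram x₀ x₁ z₀ z₁ + gram y₀ y₁ z₀ z₁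
  gram-+ = identity a b c
    where
    identity : ∀ a b c x₀ x₁ y₀ y₁ z₀ z₁ →
      a * ((x₀ + y₀) * z₀) + (b * ((x₀ + y₀) * z₁ + (x₁ + y₁) * z₀) + c * ((x₁ + y₁) * z₁))
        ≡ a * (x₀ * z₀) + (b * (x₀ * z₁ + x₁ * z₀) + c * (x₁ * z₁))
          + (a * (y₀ * z₀) + (b * (y₀ * z₁ + y₁ * z₀) + c * (y₁ * z₁)))
    identity = solve-∀

  gram-* : ∀ k x₀ x₁ z₀ z₁ → gram (k * x₀) (k * x₁) z₀ z₁ ≡ k * gram x₀ x₁ z₀ z₁
  gram-* = identity a b c
    where
    identity : ∀ a b c k x₀ x₁ z₀ z₁ →
      a * (k * x₀ * z₀) + (b * (k * x₀ * z₁ + k * x₁ * z₀) + c * (k * x₁ * z₁))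
        ≡ k * (a * (x₀ * z₀) + (b * (x₀ * z₁ + x₁ * z₀) + c * (x₁ * z₁)))
    identity = solve-∀

  gram-nonNeg : ∀ x₀ x₁ → 0ℤ ≤ gram x₀ x₁ x₀ x₁
  gram-nonNeg x₀ x₁ = *-cancelˡ-≤-pos 0ℤ _ a (subst₂ _≤_ (sym (*-zeroʳ a))
    (sym (complete-square a b c x₀ x₁))
    (+-mono-≤ (square-nonNeg (a * x₀ + b * x₁)) (square-term x₁)))

  gram-definite : ∀ x₀ x₁ → gram x₀ x₁ x₀ x₁ ≡ 0ℤ → x₀ ≡ 0ℤ × x₁ ≡ 0ℤ
  gram-definite x₀ x₁ eq with nonNeg-sum≡0
    (square-nonNeg (a * x₀ + b * x₁)) (square-term x₁)
    (trans (sym (complete-square a b c x₀ x₁)) (trans (cong (a *_) eq) (*-zeroʳ a)))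
  ... | linear²≡0 , det*x₁²≡0 = x₀≡0 , x₁≡0
    where
    x₁≡0 : x₁ ≡ 0ℤ
    x₁≡0 = [ (λ det≡0 → contradiction (sym det≡0) (<⇒≢ det>0)) , square≡0 x₁ ]
      (i*j≡0⇒i≡0∨j≡0 (a * c - b * b) det*x₁²≡0)

    x₀≡0 : x₀ ≡ 0ℤ
    x₀≡0 = [ (λ a≡0 → contradiction (sym a≡0) (<⇒≢ a>0)) , id ]
      (i*j≡0⇒i≡0∨j≡0 a (begin
        a * x₀          ≡⟨ +-identityʳ (a * x₀) ⟨
        a * x₀ + 0ℤ     ≡⟨ cong (λ t → a * x₀ + t) (*-zeroʳ b) ⟨
        a * x₀ + b * 0ℤ ≡⟨ cong (λ t → a * x₀ + b * t) x₁≡0 ⟨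
        a * x₀ + b * x₁ ≡⟨ square≡0 _ linear²≡0 ⟩
        0ℤ              ∎))
      where open ≡-Reasoning

infixr 5 _⊥_

_⊥_ : ∀ {k} → BinaryForm → PositiveForm k → PositiveForm (suc (suc k))
q ⊥ F = record
  { B          = λ x y → gram (head x) (head (tail x)) (head y) (head (tail y))
                         + B (tail (tail x)) (tail (tail y))
  ; B-cong     = λ x≗x′ y≗y′ → cong₂ _+_
      (gram-cong (x≗x′ zero) (x≗x′ (suc zero)) (y≗y′ zero) (y≗y′ (suc zero)))
      (B-cong (λ i → x≗x′ (suc (suc i))) (λ i → y≗y′ (suc (suc i))))
  ; B-sym      = λ x y → cong₂ _+_
      (gram-sym (x zero) (x (suc zero)) (y zero) (y (suc zero)))
      (B-sym (tail (tail x)) (tail (tail y)))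
  ; B-+        = λ x y z → trans
      (cong₂ _+_
        (gram-+ (x zero) (x (suc zero)) (y zero) (y (suc zero)) (z zero) (z (suc zero)))
        (B-+ (tail (tail x)) (tail (tail y)) (tail (tail z))))
      (+-interchange (gram (x zero) (x (suc zero)) _ _) (gram (y zero) (y (suc zero)) _ _) _ _)
  ; B-*        = λ k x z → trans
      (cong₂ _+_
        (gram-* k (x zero) (x (suc zero)) (z zero) (z (suc zero)))
        (B-* k (tail (tail x)) (tail (tail z))))
      (sym (*-distribˡ-+ k (gram (x zero) (x (suc zero)) _ _) _))
  ; B-nonNeg   = λ x → +-mono-≤ (gram-nonNeg (x zero) (x (suc zero))) (B-nonNeg (tail (tail x)))
  ; B-definite = λ x eq →
      let q≡0 , F≡0 = nonNeg-sum≡0 (gram-nonNeg (x zero) (x (suc zero)))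
                                   (B-nonNeg (tail (tail x))) eq
          x₀≡0 , x₁≡0 = gram-definite (x zero) (x (suc zero)) q≡0
      in λ { zero          → x₀≡0
           ; (suc zero)    → x₁≡0
           ; (suc (suc i)) → B-definite (tail (tail x)) F≡0 i }
  }
  where
  open BinaryForm q
  open PositiveForm F

-- Only norms up to `m` can occur in the images of the two basis vectors. The bound leaves room for
-- forms such as ⟨m n², m n²⟩, whose odd norms all exceed `m`.
EvenUpTo : ∀ {k} → ℤ → PositiveForm k → Set
EvenUpTo m F = ∀ x → B x x ≤ m → + 2 ∣ˢ B x x
  where open PositiveForm F

module _ (q : BinaryForm) where
  open BinaryForm q

  BinaryEvenUpTo : ℤ → Set
  BinaryEvenUpTo m = ∀ x₀ x₁ → gram x₀ x₁ x₀ x₁ ≤ m → + 2 ∣ˢ gram x₀ x₁ x₀ x₁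

  -- Both summands are nonnegative, so each is at most `m` when their sum is.
  ⊥-evenUpTo : ∀ {m k} {F : PositiveForm k} →
    BinaryEvenUpTo m → EvenUpTo m F → EvenUpTo m (q ⊥ F)
  ⊥-evenUpTo {F = F} q-even F-even x ≤m = ∣m∣n⇒∣m+n
    (q-even x₀ x₁ (≤-summandˡ (PositiveForm.B-nonNeg F (tail (tail x))) ≤m))
    (F-even (tail (tail x)) (≤-summandʳ (gram-nonNeg x₀ x₁) ≤m))
    where
    x₀ = x zero
    x₁ = x (suc zero)

  -- The cross term occurs twice, so the diagonal coefficients decide the parity.
  even-binary : ∀ m → + 2 ∣ˢ a → + 2 ∣ˢ c → BinaryEvenUpTo m
  even-binary m (divides h refl) (divides j refl) x₀ x₁ _ =
    divides (h * (x₀ * x₀) + (b * (x₀ * x₁) + j * (x₁ * x₁))) (halve h b j x₀ x₁)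
    where
    halve : ∀ h b j x₀ x₁ →
      h * + 2 * (x₀ * x₀) + (b * (x₀ * x₁ + x₁ * x₀) + j * + 2 * (x₁ * x₁))
        ≡ (h * (x₀ * x₀) + (b * (x₀ * x₁) + j * (x₁ * x₁))) * + 2
    halve = solve-∀

-- A representation in ⟨1⟩ ⊥ F, split into its ⟨1⟩-coordinate α and its F-part φ.
record ⟨1⟩⊥-Represents {k} (F : PositiveForm k) (N : ℤ-Lattice) : Set where
  open ℤ-Lattice N using (Carrierᴹ; ℤ-module) renaming (B to Bᴺ)
  field
    α         : Carrierᴹ → ℤ
    φ         : Carrierᴹ → Vector ℤ k
    α-linear  : IsLinear ℤ-module α
    φ-linear  : ∀ i → IsLinear ℤ-module (λ x → φ x i)
    isometric : ∀ x y → α x * α y + PositiveForm.B F (φ x) (φ y) ≡ Bᴺ x y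

record ⟨1⟩⊥ᵇ-Represents (q : BinaryForm) (N : ℤ-Lattice) : Set where
  open ℤ-Lattice N using (Carrierᴹ; ℤ-module) renaming (B to Bᴺ)
  field
    α β γ     : Carrierᴹ → ℤ
    α-linear  : IsLinear ℤ-module α
    β-linear  : IsLinear ℤ-module β
    γ-linear  : IsLinear ℤ-module γ
    isometric : ∀ x y →
      α x * α y + BinaryForm.gram q (β x) (γ x) (β y) (γ y) ≡ Bᴺ x y

-- Representations assembled from linear coordinates

module _ {N : ℤ-Lattice} where
  open ℤ-Lattice N using (ℤ-module)
  open LeftModule ℤ-module using (Carrierᴹ)

  coordinatewise-linear : ∀ {k} {φ : Carrierᴹ → Vector ℤ k} →
    (∀ i → IsLinear ℤ-module (λ x → φ x i)) →
    IsLeftModuleHomomorphism (ℤ-Lattice.rawLeftModule N) (LeftModule.rawLeftModule (ℤ^ k)) φ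
  coordinatewise-linear Φ = record
    { +ᴹ-isGroupHomomorphism = record
      { isMonoidHomomorphism = record
        { isMagmaHomomorphism = record
          { isRelHomomorphism = record { cong = λ x≈y i → IsLinear.⟦⟧-cong (Φ i) x≈y }
          ; homo              = λ x y i → IsLinear.+-homo (Φ i) x y
          }
        ; ε-homo = λ i → IsLinear.0-homo (Φ i)
        }
      ; ⁻¹-homo = λ x i → IsLinear.neg-homo (Φ i) x
      }
    ; *ₗ-homo = λ c x i → IsLinear.*-homo (Φ i) c x
    }

  ⟨1⟩⊥-represents : ∀ {k} {F : PositiveForm k} →
    ⟨1⟩⊥-Represents F N → lattice (⟨1⟩⊥ F) Represents N
  ⟨1⟩⊥-represents rep = (λ x → α x ∷ φ x) ,
    coordinatewise-linear (λ { zero → α-linear ; (suc i) → φ-linear i }) , isometric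
    where open ⟨1⟩⊥-Represents rep

  ⊥-represents-head : ∀ {q k} {F : PositiveForm k} →
    ⟨1⟩⊥ᵇ-Represents q N → ⟨1⟩⊥-Represents (q ⊥ F) N
  ⊥-represents-head {q} {F = F} rep = record
    { α         = α
    ; φ         = λ x → β x ∷ γ x ∷ λ _ → 0ℤ
    ; α-linear  = α-linear
    ; φ-linear  = λ { zero → β-linear ; (suc zero) → γ-linear ; (suc (suc i)) → zero-linear }
    ; isometric = λ x y → trans
        (cong (λ t → α x * α y + t)
          (trans (cong (λ t → gram (β x) (γ x) (β y) (γ y) + t)
                       (PositiveForm.B-zeroˡ F (λ _ → 0ℤ) (λ _ → refl)))
                 (+-identityʳ _)))
        (isometric x y)
    }
    where
    open ⟨1⟩⊥ᵇ-Represents rep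
    open BinaryForm q using (gram)

  ⊥-represents-tail : ∀ {q k} {F : PositiveForm k} →
    ⟨1⟩⊥-Represents F N → ⟨1⟩⊥-Represents (q ⊥ F) N
  ⊥-represents-tail {q} rep = record
    { α         = α
    ; φ         = λ x → 0ℤ ∷ 0ℤ ∷ φ x
    ; α-linear  = α-linear
    ; φ-linear  = λ { zero → zero-linear ; (suc zero) → zero-linear ; (suc (suc i)) → φ-linear i }
    ; isometric = λ x y → trans
        (cong (λ t → α x * α y + t)
          (trans (cong₂ _+_ (vanishes a b c) refl) (+-identityˡ _)))
        (isometric x y)
    }
    where
    open ⟨1⟩⊥-Represents rep
    open BinaryForm q using (a; b; c)

    vanishes : ∀ a b c → a * 0ℤ + (b * 0ℤ + c * 0ℤ) ≡ 0ℤ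
    vanishes = solve-∀

-- The obstruction to representing ⟨1, m⟩

evenUpTo⇒¬represents : ∀ {k} {F : PositiveForm k} (m : ℤ) .{{_ : Positive m}} →
  ¬ (+ 2 ∣ˢ m) → EvenUpTo m F → ¬ (lattice (⟨1⟩⊥ F) Represents ⟨ 1ℤ , m ⟩)
evenUpTo⇒¬represents {F = F} m m-odd even (σ , _ , isometric) = m-odd (even-tail-f f₀≡0)
  where
  open PositiveForm F

  e f : Vector ℤ _
  e = σ (1ℤ ∷ 0ℤ ∷ [])
  f = σ (0ℤ ∷ 1ℤ ∷ [])

  norm-e : head e * head e + B (tail e) (tail e) ≡ 1ℤ
  norm-e = trans (isometric _ _) (compute m)
    where
    compute : ∀ m → 1ℤ + (m * 0ℤ + 0ℤ) ≡ 1ℤ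
    compute = solve-∀

  norm-f : head f * head f + B (tail f) (tail f) ≡ m
  norm-f = trans (isometric _ _) (compute m)
    where
    compute : ∀ m → 0ℤ + (m * 1ℤ + 0ℤ) ≡ m
    compute = solve-∀

  e⊥f : head e * head f + B (tail e) (tail f) ≡ 0ℤ
  e⊥f = trans (isometric _ _) (compute m)
    where
    compute : ∀ m → 0ℤ + (m * 0ℤ + 0ℤ) ≡ 0ℤ
    compute = solve-∀

  1≤m : 1ℤ ≤ m
  1≤m = i<j⇒suc[i]≤j (positive⁻¹ m)

  even-e : + 2 ∣ˢ B (tail e) (tail e)
  even-e = even (tail e) (≤-trans
    (≤-summandʳ (square-nonNeg (head e)) (≤-reflexive norm-e)) 1≤m)

  even-tail-f : head f ≡ 0ℤ → + 2 ∣ˢ m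
  even-tail-f f₀≡0 = subst (+ 2 ∣ˢ_) eq (even (tail f) (≤-reflexive eq))
    where
    eq : B (tail f) (tail f) ≡ m
    eq = trans (sym (+-identityˡ _))
      (subst (λ t → t * t + B (tail f) (tail f) ≡ m) f₀≡0 norm-f)

  e₀≢0 : ¬ (head e ≡ 0ℤ)
  e₀≢0 e₀≡0 = 2∤1 (subst (+ 2 ∣ˢ_) rest≡1 even-e)
    where
    rest≡1 : B (tail e) (tail e) ≡ 1ℤ
    rest≡1 = trans (sym (+-identityˡ _))
      (subst (λ t → t * t + B (tail e) (tail e) ≡ 1ℤ) e₀≡0 norm-e)

    2∤1 : ¬ (+ 2 ∣ˢ 1ℤ)
    2∤1 2∣1 = contradiction (ℕᵈ.∣1⇒≡1 (∣⇒∣ᵤ 2∣1)) λ ()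

  tail-e≡0 : ∀ i → tail e i ≡ 0ℤ
  -- As `head e` is nonzero, its square is at least 1, and `head e * head e - 1ℤ` plus the norm of
  -- the tail is a vanishing sum of nonnegative terms.
  tail-e≡0 = B-definite (tail e) (proj₂ (nonNeg-sum≡0
    (i≤j⇒0≤j-i (i<j⇒suc[i]≤j (square-pos (head e) e₀≢0)))
    (B-nonNeg (tail e))
    (trans (regroup (head e * head e) _) (cong (_- 1ℤ) norm-e))))
    where
    regroup : ∀ s t → s - 1ℤ + t ≡ s + t - 1ℤ
    regroup = solve-∀

  f₀≡0 : head f ≡ 0ℤ
  f₀≡0 = [ (λ e₀≡0 → contradiction e₀≡0 e₀≢0) , id ]′
    (i*j≡0⇒i≡0∨j≡0 (head e) (begin
      head e * head f                        ≡⟨ +-identityʳ _ ⟨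
      head e * head f + 0ℤ                   ≡⟨ cong (λ t → head e * head f + t)
                                                     (B-zeroˡ (tail f) tail-e≡0) ⟨
      head e * head f + B (tail e) (tail f)  ≡⟨ e⊥f ⟩
      0ℤ                                     ∎))
    where open ≡-Reasoning

i<j⇒0<j-i : ∀ {i j} → i < j → 0ℤ < j - i
i<j⇒0<j-i {i} {j} i<j = subst (_< j - i) (+-inverseʳ i) (+-monoˡ-< (- i) i<j)

-- Representing the proper sublattices

-- The form `q` only has to pull back to the remainder B - α² along (β, γ); these two functionals
-- may be dependent.
HasSplitting : ℤ → ℤ-Lattice → Set
HasSplitting m N = ∃ λ q → BinaryEvenUpTo q m × ⟨1⟩⊥ᵇ-Represents q N

-- Positivity of the determinant for m = 1: (n - 1)² < (n - 1) n ≤ n² - 1. It fails at t = n.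
t²<[n²∸1]*1 : ∀ {t n} → 2 ℕ.≤ n → t ℕ.< n → t ℕ.* t ℕ.< (n ℕ.* n ℕ.∸ 1) ℕ.* 1
t²<[n²∸1]*1 {t} {suc p} (s≤s 1≤p) (s≤s t≤p) = begin-strict
  t ℕ.* t                        ≤⟨ ℕₚ.*-mono-≤ t≤p t≤p ⟩
  p ℕ.* p                        <⟨ ℕₚ.*-monoʳ-< p {{ℕ.>-nonZero 1≤p}} (ℕₚ.n<1+n p) ⟩
  p ℕ.* suc p                    ≤⟨ ℕₚ.m≤n+m _ p ⟩
  p ℕ.+ p ℕ.* suc p              ≡⟨ ℕₚ.*-identityʳ _ ⟨
  (p ℕ.+ p ℕ.* suc p) ℕ.* 1      ∎
  where open ℕₚ.≤-Reasoning

-- With s = n² - 1 > 1 one has n² = 1 + s < 2 s ≤ s m, so for m ≥ 2 the value t = n is admissible.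
t²<[n²∸1]*m : ∀ {t n m} → 2 ℕ.≤ n → 2 ℕ.≤ m → t ℕ.≤ n → t ℕ.* t ℕ.< (n ℕ.* n ℕ.∸ 1) ℕ.* m
t²<[n²∸1]*m {t} {n@(suc p)} {m} (s≤s 1≤p) 2≤m t≤n = begin-strict
  t ℕ.* t      ≤⟨ ℕₚ.*-mono-≤ t≤n t≤n ⟩
  1 ℕ.+ s      <⟨ ℕₚ.+-monoˡ-< s 1<s ⟩
  s ℕ.+ s      ≡⟨ cong (s ℕ.+_) (ℕₚ.+-identityʳ s) ⟨
  2 ℕ.* s      ≡⟨ ℕₚ.*-comm 2 s ⟩
  s ℕ.* 2      ≤⟨ ℕₚ.*-monoʳ-≤ s 2≤m ⟩
  s ℕ.* m      ∎
  where
  open ℕₚ.≤-Reasoning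
  s = p ℕ.+ p ℕ.* n

  1<s : 1 ℕ.< s
  1<s = ℕₚ.+-mono-≤ 1≤p (ℕₚ.*-mono-≤ 1≤p (s≤s z≤n))

-- If the remainder in [0, n) is even, subtracting n makes it odd.
odd-residue : ∀ n .{{_ : ℕ.NonZero n}} g → + n ≡ 1ℤ + g * + 2 → ∀ b →
  ∃ λ h → ∃ λ c → b ≡ (1ℤ + h * + 2) + c * + n × ∣ 1ℤ + h * + 2 ∣ ℕ.≤ n
odd-residue n g n-odd b with even⊎odd (+ (b %ℕ n))
... | h , inj₂ r≡1+2h = h , b /ℕ n ,
  trans (a≡a%ℕn+[a/ℕn]*n b n) (cong (_+ b /ℕ n * + n) r≡1+2h) ,
  subst (λ r → ∣ r ∣ ℕ.≤ n) r≡1+2h (ℕₚ.<⇒≤ (n%ℕd<d b n))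
-- The residue is r - n = 2h - (1 + 2g), and the quotient grows by one to compensate. Its absolute
-- value n - r reaches n when r = 0, so the bound cannot be strict.
... | h , inj₁ r≡2h = h - g - 1ℤ , b /ℕ n + 1ℤ ,
  trans (a≡a%ℕn+[a/ℕn]*n b n)
    (trans (shift (+ (b %ℕ n)) (+ n) (b /ℕ n)) (cong (_+ _) r-n)) ,
  subst (λ r → ∣ r ∣ ℕ.≤ n) r-n
    (subst (λ r → ∣ r ∣ ℕ.≤ n) (sym (m-n≡m⊖n (b %ℕ n) n))
      (subst (ℕ._≤ n) (sym (∣⊖∣-≤ (ℕₚ.<⇒≤ (n%ℕd<d b n)))) (ℕₚ.m∸n≤m n (b %ℕ n))))
  where
  shift : ∀ r n q → r + q * n ≡ r - n + (q + 1ℤ) * n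
  shift = solve-∀

  regroup : ∀ h g → h * + 2 - (1ℤ + g * + 2) ≡ 1ℤ + (h - g - 1ℤ) * + 2
  regroup = solve-∀

  r-n : + (b %ℕ n) - + n ≡ 1ℤ + (h - g - 1ℤ) * + 2
  r-n = trans (cong₂ _-_ r≡2h n-odd) (regroup h g)

-- The remainder c u² has rank one; ⟨c, c⟩ pads it to a binary form.
sparse-splitting : ∀ {N : ℤ-Lattice} → let open ℤ-Lattice N in
  ∀ {m c α u} → 0ℤ < m → m < c →
  IsLinear ℤ-module α → IsLinear ℤ-module u →
  (∀ x y → α x * α y + c * (u x * u y) ≡ B x y) → HasSplitting m N
sparse-splitting {N} {m} {c} {α} {u} 0<m m<c α-linear u-linear isometric = q , even , record
  { α = α ; β = u ; γ = λ _ → 0ℤ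
  ; α-linear = α-linear ; β-linear = u-linear ; γ-linear = zero-linear
  ; isometric = λ x y → trans (drop-γ c (α x) (α y) (u x) (u y)) (isometric x y)
  }
  where
  0<c : 0ℤ < c
  0<c = <-trans 0<m m<c

  drop-γ : ∀ c α α′ u u′ →
    α * α′ + (c * (u * u′) + (0ℤ * (u * 0ℤ + 0ℤ * u′) + c * (0ℤ * 0ℤ))) ≡ α * α′ + c * (u * u′)
  drop-γ = solve-∀

  det : ∀ c → c * c ≡ c * c - 0ℤ * 0ℤ
  det = solve-∀

  q : BinaryForm
  q = record
    { a = c ; b = 0ℤ ; c = c ; a>0 = 0<c
    ; det>0 = subst (0ℤ <_) (det c) (*-pos-pos 0<c 0<c) }

  factor : ∀ c x₀ x₁ → c * (x₀ * x₀) + (0ℤ * (x₀ * x₁ + x₁ * x₀) + c * (x₁ * x₁))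
    ≡ c * (x₀ * x₀ + x₁ * x₁)
  factor = solve-∀

  even : BinaryEvenUpTo q m
  -- A nonzero norm is at least `c`, hence greater than `m`; only the norm 0 remains.
  even x₀ x₁ ≤m with x₀ * x₀ + x₁ * x₁ ≟ 0ℤ
  ... | yes s≡0 = divides 0ℤ (trans (factor c x₀ x₁) (trans (cong (c *_) s≡0) (*-zeroʳ c)))
  ... | no  s≢0 = contradiction m<c
    (≤⇒≯ (≤-trans c≤c*s (≤-trans (≤-reflexive (sym (factor c x₀ x₁))) ≤m)))
    where
    s : ℤ
    s = x₀ * x₀ + x₁ * x₁

    0<s : 0ℤ < s
    0<s = ≤∧≢⇒< (+-mono-≤ (square-nonNeg x₀) (square-nonNeg x₁)) (s≢0 ∘ sym)

    c≤c*s : c ≤ c * s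
    c≤c*s = subst (_≤ c * s) (*-identityʳ c)
      (*-monoˡ-≤-nonNeg c {{nonNegative (<⇒≤ 0<c)}} (i<j⇒suc[i]≤j 0<s))

-- Splittings from a single congruence on the coordinates

module _ (m : ℤ) (0<m : 0ℤ < m) {N : ℤ-Lattice} {X Y : ℤ-Lattice.Carrierᴹ N → ℤ}
  (X-linear : IsLinear (ℤ-Lattice.ℤ-module N) X)
  (Y-linear : IsLinear (ℤ-Lattice.ℤ-module N) Y)
  (B-diagonal : ∀ x y → X x * X y + m * (Y x * Y y) ≡ ℤ-Lattice.B N x y)
  where
  open ℤ-Lattice N using (Carrierᴹ; ℤ-module)

  splitting-Y≡un : ∀ {n u} → 2 ℕ.≤ n → IsLinear ℤ-module u →
    (∀ x → Y x ≡ u x * + n) → HasSplitting m N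
  splitting-Y≡un {n} {u} 2≤n u-linear Y≡u*n = sparse-splitting 0<m m<mn² X-linear u-linear
    λ x y → trans (regroup m (+ n) (X x) (X y) (u x) (u y))
      (trans (cong₂ (λ s t → X x * X y + m * (s * t)) (sym (Y≡u*n x)) (sym (Y≡u*n y)))
             (B-diagonal x y))
    where
    regroup : ∀ m n x x′ u u′ →
      x * x′ + m * (n * n) * (u * u′) ≡ x * x′ + m * (u * n * (u′ * n))
    regroup = solve-∀

    m<mn² : m < m * (+ n * + n)
    m<mn² = subst₂ _<_ (*-identityʳ m) (cong (m *_) (pos-* n n))
      (*-monoˡ-<-pos m {{positive 0<m}} (+<+ (ℕₚ.≤-trans (s≤s (s≤s z≤n)) (ℕₚ.*-mono-≤ 2≤n 2≤n))))

  -- Substituting x = y + 2u turns x² + m y² into 4u² + 4uy + (1 + m) y². This is already even, so α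
  -- = 0.
  splitting-X≡Y+2u : + 2 ∣ˢ 1ℤ + m → ∀ {u} → IsLinear ℤ-module u →
    (∀ x → X x ≡ Y x + u x * + 2) → HasSplitting m N
  splitting-X≡Y+2u 2∣1+m {u} u-linear X≡Y+2u =
    q , even-binary q m (divides (+ 2) refl) 2∣1+m , record
    { α = λ _ → 0ℤ ; β = u ; γ = Y
    ; α-linear = zero-linear ; β-linear = u-linear ; γ-linear = Y-linear
    ; isometric = λ x y → trans (expand m (u x) (u y) (Y x) (Y y))
        (trans (cong₂ (λ s t → s * t + m * (Y x * Y y)) (sym (X≡Y+2u x)) (sym (X≡Y+2u y)))
               (B-diagonal x y))
    }
    where
    expand : ∀ m u u′ y y′ →
      0ℤ * 0ℤ + (+ 4 * (u * u′) + (+ 2 * (u * y′ + y * u′) + (1ℤ + m) * (y * y′)))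
        ≡ (y + u * + 2) * (y′ + u′ * + 2) + m * (y * y′)
    expand = solve-∀

    det : ∀ m → + 4 * m ≡ + 4 * (1ℤ + m) - + 2 * + 2
    det = solve-∀

    q : BinaryForm
    q = record
      { a = + 4 ; b = + 2 ; c = 1ℤ + m ; a>0 = +<+ (s≤s z≤n)
      ; det>0 = subst (0ℤ <_) (det m) (*-pos-pos {+ 4} (+<+ (s≤s z≤n)) 0<m) }

  -- The norm 4u² + m y² has the parity of y, so α = y. The remainder 4u² + (m - 1) y² is definite
  -- precisely because m > 1.
  splitting-X≡2u : + 2 ∣ˢ m - 1ℤ → 1ℤ < m → ∀ {u} → IsLinear ℤ-module u →
    (∀ x → X x ≡ u x * + 2) → HasSplitting m N
  splitting-X≡2u 2∣m-1 1<m {u} u-linear X≡2u =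
    q , even-binary q m (divides (+ 2) refl) 2∣m-1 , record
    { α = Y ; β = u ; γ = Y
    ; α-linear = Y-linear ; β-linear = u-linear ; γ-linear = Y-linear
    ; isometric = λ x y → trans (expand m (u x) (u y) (Y x) (Y y))
        (trans (cong₂ (λ s t → s * t + m * (Y x * Y y)) (sym (X≡2u x)) (sym (X≡2u y)))
               (B-diagonal x y))
    }
    where
    expand : ∀ m u u′ y y′ →
      y * y′ + (+ 4 * (u * u′) + (0ℤ * (u * y′ + y * u′) + (m - 1ℤ) * (y * y′)))
        ≡ u * + 2 * (u′ * + 2) + m * (y * y′)
    expand = solve-∀

    det : ∀ m → + 4 * (m - 1ℤ) ≡ + 4 * (m - 1ℤ) - 0ℤ * 0ℤ
    det = solve-∀

    q : BinaryForm
    q = record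
      { a = + 4 ; b = 0ℤ ; c = m - 1ℤ ; a>0 = +<+ (s≤s z≤n)
      ; det>0 = subst (0ℤ <_) (det m) (*-pos-pos {+ 4} (+<+ (s≤s z≤n)) (i<j⇒0<j-i 1<m)) }

  -- For b and n odd, α = u has the parity of the norm, so the remainder is even.
  splitting-X≡Yb+un : ∀ {a b n u} → 0ℤ < a → a ≡ n * n - 1ℤ → b * b < a * m →
    + 2 ∣ˢ a → + 2 ∣ˢ b * b + m → IsLinear ℤ-module u →
    (∀ x → X x ≡ Y x * b + u x * n) → HasSplitting m N
  splitting-X≡Yb+un {a} {b} {n} {u} 0<a refl b²<am 2∣a 2∣c u-linear X≡Yb+un =
    q , even-binary q m 2∣a 2∣c , record
    { α = u ; β = u ; γ = Y
    ; α-linear = u-linear ; β-linear = u-linear ; γ-linear = Y-linear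
    ; isometric = λ x y → trans (expand m n b (u x) (u y) (Y x) (Y y))
        (trans (cong₂ (λ s t → s * t + m * (Y x * Y y)) (sym (X≡Yb+un x)) (sym (X≡Yb+un y)))
               (B-diagonal x y))
    }
    where
    expand : ∀ m n b u u′ y y′ →
      u * u′ + ((n * n - 1ℤ) * (u * u′) + (n * b * (u * y′ + y * u′) + (b * b + m) * (y * y′)))
        ≡ (y * b + u * n) * (y′ * b + u′ * n) + m * (y * y′)
    expand = solve-∀

    det : ∀ m n b → (n * n - 1ℤ) * m - b * b ≡ (n * n - 1ℤ) * (b * b + m) - n * b * (n * b)
    det = solve-∀

    q : BinaryForm
    q = record
      { a = n * n - 1ℤ ; b = n * b ; c = b * b + m ; a>0 = 0<a
      ; det>0 = subst (0ℤ <_) (det m n b) (i<j⇒0<j-i b²<am) }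

-- Choice of the splitting by the parity of the modulus

module _ {m : ℤ} (0<m : 0ℤ < m) (m-odd : ∃ λ μ → m ≡ 1ℤ + μ * + 2)
  {N : ℤ-Lattice} {X Y : ℤ-Lattice.Carrierᴹ N → ℤ}
  (X-linear : IsLinear (ℤ-Lattice.ℤ-module N) X)
  (Y-linear : IsLinear (ℤ-Lattice.ℤ-module N) Y)
  (B-diagonal : ∀ x y → X x * X y + m * (Y x * Y y) ≡ ℤ-Lattice.B N x y)
  where
  open ℤ-Lattice N using (Carrierᴹ; ℤ-module)

  2∣m-1 : + 2 ∣ˢ m - 1ℤ
  2∣m-1 = let μ , m≡1+2μ = m-odd in
    divides μ (trans (cong (_- 1ℤ) m≡1+2μ) (cancel μ))
    where
    cancel : ∀ μ → 1ℤ + μ * + 2 - 1ℤ ≡ μ * + 2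
    cancel = solve-∀

  2∣odd²+m : ∀ h → + 2 ∣ˢ (1ℤ + h * + 2) * (1ℤ + h * + 2) + m
  2∣odd²+m h = let μ , m≡1+2μ = m-odd in
    divides (1ℤ + μ + (h + h * h) * + 2)
      (trans (cong (λ t → (1ℤ + h * + 2) * (1ℤ + h * + 2) + t) m≡1+2μ) (halve h μ))
    where
    halve : ∀ h μ → (1ℤ + h * + 2) * (1ℤ + h * + 2) + (1ℤ + μ * + 2)
      ≡ (1ℤ + μ + (h + h * h) * + 2) * + 2
    halve = solve-∀

  -- For m = 1 the coordinates are interchangeable.
  splitting-X≡un : ∀ {n u} → m ≡ 1ℤ → 2 ℕ.≤ n → IsLinear ℤ-module u →
    (∀ x → X x ≡ u x * + n) → HasSplitting m N
  splitting-X≡un refl 2≤n u-linear =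
    splitting-Y≡un 1ℤ 0<m Y-linear X-linear
      (λ x y → trans (swap (X x) (X y) (Y x) (Y y)) (B-diagonal x y)) 2≤n u-linear
    where
    swap : ∀ x x′ y y′ → y * y′ + 1ℤ * (x * x′) ≡ x * x′ + 1ℤ * (y * y′)
    swap = solve-∀

  -- The remainder 4u² + (m - 1) y² degenerates at m = 1, where the coordinates are interchanged
  -- instead.
  splitting-2∣X : ∀ {u} → IsLinear ℤ-module u → (∀ x → X x ≡ u x * + 2) → HasSplitting m N
  splitting-2∣X u-linear X≡2u with m ≟ 1ℤ
  ... | yes m≡1 = splitting-X≡un m≡1 ℕₚ.≤-refl u-linear X≡2u
  ... | no  m≢1 = splitting-X≡2u m 0<m X-linear Y-linear B-diagonal 2∣m-1
    (≤∧≢⇒< (i<j⇒suc[i]≤j 0<m) (m≢1 ∘ sym)) u-linear X≡2u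

  -- An even modulus can be weakened to 2. Then only the parity of `b` matters, and the halves of
  -- `b` and `n` go into the new quotient functional.
  splitting-n-even : ∀ {n b g u} → + n ≡ g * + 2 → IsLinear ℤ-module u →
    (∀ x → X x ≡ Y x * b + u x * + n) → HasSplitting m N
  splitting-n-even {n} {b} {g} {u} n≡2g u-linear X≡Yb+un with even⊎odd b
  ... | h , inj₁ b≡2h = splitting-2∣X
    (+-linear (*-linear Y-linear h) (*-linear u-linear g))
    λ x → trans (X≡Yb+un x) (trans
      (cong₂ (λ s t → Y x * s + u x * t) b≡2h n≡2g) (collect (Y x) (u x) h g))
    where
    collect : ∀ y u h g → y * (h * + 2) + u * (g * + 2) ≡ (y * h + u * g) * + 2
    collect = solve-∀
  ... | h , inj₂ b≡1+2h = splitting-X≡Y+2u m 0<m X-linear Y-linear B-diagonal (2∣odd²+m 0ℤ)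
    (+-linear (*-linear Y-linear h) (*-linear u-linear g))
    λ x → trans (X≡Yb+un x) (trans
      (cong₂ (λ s t → Y x * s + u x * t) b≡1+2h n≡2g) (collect (Y x) (u x) h g))
    where
    collect : ∀ y u h g → y * (1ℤ + h * + 2) + u * (g * + 2) ≡ y + (y * h + u * g) * + 2
    collect = solve-∀

  -- Changing `b` by a multiple of `n` only changes the quotient functional, from `u` to `v`, so `b`
  -- may be replaced by the odd residue `r` with |r| ≤ n.
  splitting-n-odd : ∀ {n b g u} → 2 ℕ.≤ n → + n ≡ 1ℤ + g * + 2 → IsLinear ℤ-module u →
    (∀ x → X x ≡ Y x * b + u x * + n) → HasSplitting m N
  splitting-n-odd {n} {b} {g} {u} 2≤n n≡1+2g u-linear X≡Yb+un
    with odd-residue n {{ℕ.>-nonZero (ℕₚ.<-trans (s≤s z≤n) 2≤n)}} g n≡1+2g b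
  ... | h , c , b≡r+cn , ∣r∣≤n = by-size
    where
    r : ℤ
    r = 1ℤ + h * + 2

    v : Carrierᴹ → ℤ
    v x = Y x * c + u x

    v-linear : IsLinear ℤ-module v
    v-linear = +-linear (*-linear Y-linear c) u-linear

    X≡Yr+vn : ∀ x → X x ≡ Y x * r + v x * + n
    X≡Yr+vn x = trans (X≡Yb+un x)
      (trans (cong (λ t → Y x * t + u x * + n) b≡r+cn) (collect (Y x) (u x) r c (+ n)))
      where
      collect : ∀ y u r c n → y * (r + c * n) + u * n ≡ y * r + (y * c + u) * n
      collect = solve-∀

    n²-1 : + (n ℕ.* n ℕ.∸ 1) ≡ + n * + n - 1ℤ
    n²-1 = trans (sym (⊖-≥ (ℕₚ.≤-trans (s≤s z≤n) (ℕₚ.*-mono-≤ 2≤n 2≤n))))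
      (trans (sym (m-n≡m⊖n (n ℕ.* n) 1)) (cong (_- 1ℤ) (pos-* n n)))

    0<n²-1 : 0ℤ < + (n ℕ.* n ℕ.∸ 1)
    0<n²-1 = +<+ (ℕₚ.m<n⇒0<n∸m (ℕₚ.≤-trans (s≤s (s≤s z≤n)) (ℕₚ.*-mono-≤ 2≤n 2≤n)))

    2∣n²-1 : + 2 ∣ˢ + (n ℕ.* n ℕ.∸ 1)
    2∣n²-1 = divides ((g + g * g) * + 2)
      (trans n²-1 (trans (cong (λ t → t * t - 1ℤ) n≡1+2g) (halve g)))
      where
      halve : ∀ g → (1ℤ + g * + 2) * (1ℤ + g * + 2) - 1ℤ ≡ (g + g * g) * + 2 * + 2
      halve = solve-∀

    r²<[n²-1]m : ∣ r ∣ ℕ.* ∣ r ∣ ℕ.< (n ℕ.* n ℕ.∸ 1) ℕ.* ∣ m ∣ →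
      r * r < + (n ℕ.* n ℕ.∸ 1) * m
    r²<[n²-1]m lt = subst₂ _<_ (sym (i*i≡+∣i∣*∣i∣ r))
      (trans (pos-* (n ℕ.* n ℕ.∸ 1) ∣ m ∣)
             (cong (+ (n ℕ.* n ℕ.∸ 1) *_) (0≤i⇒+∣i∣≡i (<⇒≤ 0<m))))
      (+<+ lt)

    small-r : ∣ r ∣ ℕ.* ∣ r ∣ ℕ.< (n ℕ.* n ℕ.∸ 1) ℕ.* ∣ m ∣ → HasSplitting m N
    small-r lt = splitting-X≡Yb+un m 0<m X-linear Y-linear B-diagonal
      0<n²-1 n²-1 (r²<[n²-1]m lt) 2∣n²-1 (2∣odd²+m h) v-linear X≡Yr+vn

    by-size : HasSplitting m N
    by-size with m ≟ 1ℤ | ∣ r ∣ ℕₚ.≟ n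
    ... | no  m≢1 | _         = small-r (t²<[n²∸1]*m 2≤n 2≤∣m∣ ∣r∣≤n)
      where
      2≤∣m∣ : 2 ℕ.≤ ∣ m ∣
      2≤∣m∣ = drop‿+≤+ (≤-trans (i<j⇒suc[i]≤j (≤∧≢⇒< (i<j⇒suc[i]≤j 0<m) (m≢1 ∘ sym)))
        (≤-reflexive (sym (0≤i⇒+∣i∣≡i (<⇒≤ 0<m)))))
    ... | yes m≡1 | no  ∣r∣≢n = small-r (subst
      (λ t → ∣ r ∣ ℕ.* ∣ r ∣ ℕ.< (n ℕ.* n ℕ.∸ 1) ℕ.* ∣ t ∣) (sym m≡1)
      (t²<[n²∸1]*1 2≤n (ℕₚ.≤∧≢⇒< ∣r∣≤n ∣r∣≢n)))
    -- The determinant would be (n² - 1) - n² = -1. But now n divides r, hence also x.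
    ... | yes m≡1 | yes ∣r∣≡n with subst (λ t → + t ∣ˢ r) ∣r∣≡n ∣m∣∣m
    ...   | divides δ r≡δn = splitting-X≡un m≡1 2≤n
      (+-linear (*-linear Y-linear δ) v-linear)
      λ x → trans (X≡Yr+vn x)
        (trans (cong (λ t → Y x * t + v x * + n) r≡δn) (collect (Y x) (v x) δ (+ n)))
      where
      collect : ∀ y v δ n → y * (δ * n) + v * n ≡ (y * δ + v) * n
      collect = solve-∀

  splitting-n∣X-Yb : ∀ {n b u} → 2 ℕ.≤ n → IsLinear ℤ-module u →
    (∀ x → X x ≡ Y x * b + u x * + n) → HasSplitting m N
  splitting-n∣X-Yb {n} 2≤n u-linear X≡Yb+un with even⊎odd (+ n)
  ... | g , inj₁ n≡2g   = splitting-n-even {g = g} n≡2g u-linear X≡Yb+un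
  ... | g , inj₂ n≡1+2g = splitting-n-odd {g = g} 2≤n n≡1+2g u-linear X≡Yb+un

-- Proper sublattices of ⟨1, m⟩

module _ {m : ℤ} .{{_ : Positive m}} (K : Sublattice ⟨ 1ℤ , m ⟩) where
  open Sublattice K using (subset; resp-≈; +-closed; *ₗ-closed)

  private
    X Y : ∃ subset → ℤ
    X (x , _) = x zero
    Y (x , _) = x (suc zero)

    X-linear : IsLinear (subModule K) X
    X-linear = record
      { ⟦⟧-cong = λ x≗y → x≗y zero ; +-homo = λ _ _ → refl ; *-homo = λ _ _ → refl }

    Y-linear : IsLinear (subModule K) Y
    Y-linear = record
      { ⟦⟧-cong = λ x≗y → x≗y (suc zero) ; +-homo = λ _ _ → refl ; *-homo = λ _ _ → refl }

    B-diagonal : ∀ x y → X x * X y + m * (Y x * Y y) ≡ ℤ-Lattice.B (asLattice K) x y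
    B-diagonal x y = expand m (X x) (X y) (Y x) (Y y)
      where
      expand : ∀ m x x′ y y′ →
        x * x′ + m * (y * y′) ≡ 1ℤ * (x * x′) + (m * (y * y′) + 0ℤ)
      expand = solve-∀

  -- With e = (b, 1) and y′ the second coordinate of e′, the vector e′ - y′ e is (1, 0), and (b, 1)
  -- and (1, 0) generate ℤ².
  contains-every-vector : (e e′ : ∃ subset) → Y e ≡ 1ℤ → X e′ + Y e′ * - X e ≡ 1ℤ → ∀ v → subset v
  contains-every-vector (e , e∈K) (e′ , e′∈K) y≡1 x-yb≡1 v = resp-≈
    (λ { zero → x-coordinate ; (suc zero) → y-coordinate })
    (+-closed (*ₗ-closed s e′∈K) (*ₗ-closed (v (suc zero) - s * e′ (suc zero)) e∈K))
    where
    open ≡-Reasoning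

    b s : ℤ
    b = e zero
    -- The value at `v` of x - b y, which vanishes at `e` and is 1 at `e′`; it is therefore the
    -- coefficient of `e′`.
    s = v zero - v (suc zero) * b

    x-coordinate : s * e′ zero + (v (suc zero) - s * e′ (suc zero)) * b ≡ v zero
    x-coordinate = begin
      s * e′ zero + (v (suc zero) - s * e′ (suc zero)) * b
        ≡⟨ regroup s (e′ zero) (e′ (suc zero)) (v (suc zero)) b ⟩
      s * (e′ zero + e′ (suc zero) * - b) + v (suc zero) * b
        ≡⟨ cong (λ t → s * t + v (suc zero) * b) x-yb≡1 ⟩
      s * 1ℤ + v (suc zero) * b
        ≡⟨ cancel (v zero) (v (suc zero) * b) ⟩
      v zero ∎
      where
      regroup : ∀ s x y w b → s * x + (w - s * y) * b ≡ s * (x + y * - b) + w * b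
      regroup = solve-∀

      cancel : ∀ i j → (i - j) * 1ℤ + j ≡ i
      cancel = solve-∀

    y-coordinate :
      s * e′ (suc zero) + (v (suc zero) - s * e′ (suc zero)) * e (suc zero) ≡ v (suc zero)
    y-coordinate = trans
      (cong (λ t → s * e′ (suc zero) + (v (suc zero) - s * e′ (suc zero)) * t) y≡1)
      (cancel (s * e′ (suc zero)) (v (suc zero)))
      where
      cancel : ∀ i j → i + (j - i) * 1ℤ ≡ j
      cancel = solve-∀

  proper⇒splitting : (∃ λ μ → m ≡ 1ℤ + μ * + 2) → Proper K → HasSplitting m (asLattice K)
  proper⇒splitting m-odd K-proper with onto⊎divisible (asLattice K) Y-linear
  ... | inj₂ (n , u , 2≤n , u-linear , Y≡un) =
    splitting-Y≡un m (positive⁻¹ m) X-linear Y-linear B-diagonal 2≤n u-linear Y≡un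
  -- The slope b is the first coordinate of a vector of K with y = 1. If x - b y also takes the
  -- value 1, then K is everything; otherwise some n ≥ 2 divides it on K.
  ... | inj₁ (e , Ye≡1) with onto⊎divisible (asLattice K)
                              (+-linear X-linear (*-linear Y-linear (- X e)))
  ...   | inj₁ (e′ , eq) = contradiction (contains-every-vector e e′ Ye≡1 eq) K-proper
  ...   | inj₂ (n , u , 2≤n , u-linear , X-Yb≡un) =
    splitting-n∣X-Yb (positive⁻¹ m) m-odd X-linear Y-linear B-diagonal 2≤n u-linear
      λ x → trans (isolate (X x) (Y x) (X e)) (cong (λ t → Y x * X e + t) (X-Yb≡un x))
    where
    isolate : ∀ x y b → x ≡ y * b + (x + y * - b)
    isolate = solve-∀

-- One form for all sublattices, and the conclusion

common-form : ∀ {m} .{{_ : Positive m}} → (∃ λ μ → m ≡ 1ℤ + μ * + 2) →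
  (Ks : List (Sublattice ⟨ 1ℤ , m ⟩)) → All Proper Ks →
  ∃₂ λ k (F : PositiveForm k) →
    EvenUpTo m F × All (λ K → ⟨1⟩⊥-Represents F (asLattice K)) Ks
common-form m-odd List.[] All.[] = 0 , trivial , (λ _ _ → divides 0ℤ refl) , All.[]
common-form m-odd (K List.∷ Ks) (K-proper All.∷ Ks-proper)
  with proper⇒splitting K m-odd K-proper | common-form m-odd Ks Ks-proper
... | q , q-even , q-represents | k , F , F-even , F-represents =
  -- The new sublattice uses the block `q` and is zero on `F`; the representations of the others are
  -- extended by zero on `q`.
  suc (suc k) , q ⊥ F , ⊥-evenUpTo q {F = F} q-even F-even ,
  ⊥-represents-head q-represents All.∷ All.map ⊥-represents-tail F-represents

proposition4p2 : (m : ℤ) .{{_ : Positive m}} → ¬ (+ 2 ∣ m) → ¬ Recoverable ⟨ 1ℤ , m ⟩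
proposition4p2 m 2∤m (Ks , Ks-proper , recovers) with even⊎odd m
... | h , inj₁ m≡2h   = 2∤m (∣⇒∣ᵤ (divides h m≡2h))
... | h , inj₂ m≡1+2h =
  let k , F , F-even , F-represents = common-form (h , m≡1+2h) Ks Ks-proper in
  evenUpTo⇒¬represents {F = F} m (2∤m ∘ ∣⇒∣ᵤ) F-even
    (recovers (lattice (⟨1⟩⊥ F)) (All.map ⟨1⟩⊥-represents F-represents))
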